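{- Let $\lambda$ be a real number, let $\Lambda=\{\lambda_n\}_{n\ge0}$ be the sequence $\lambda_n=\lambda^n$ for all $n\ge 0$, and let $n\ge 0$ and $m\ge 1$ be integers. Then $(V_n[\Lambda])^m$ is the vertically-recurrent matrix whose associated sequence is $\{(\lambda m)^i\}_{i\ge0}$; that is, $(V_n[\Lambda])^m=V_n[\Lambda^{(m)}]$ with $\Lambda^{(m)}=\{(\lambda m)^i\}_{i\ge 0}$ (where $x^0=1$ for all $x$).
   Context: Rows and columns of matrices are indexed from $0$. Given a sequence $\Lambda=\{\lambda_n\}_{n\ge0}$ of real numbers with $\lambda_0=1$, define numbers $a_{i,j}$ ($i,j\ge 0$) by $a_{i,0}=\lambda_i$ for $i\ge 0$, $a_{i,j}=0$ for $i<j$, and $$a_{i,j}=\sum_{l=j-1}^{i-1}\lambda_{i-1-l}\,a_{l,j-1}\qquad (i\ge j\ge 1).$$ The vertically-recurrent matrix with associated sequence $\Lambda$, of order $(n+1)\times(n+1)$, is $V_n[\Lambda]=[a_{i,j}]_{0\le i,j\le n}$. -}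

module Defs where

open import Algebra.Bundles using (CommutativeRing; Semiring)
open import Algebra.Structures using (IsCommutativeRing)
open import Data.Bool.Base using (if_then_else_)
open import Data.Fin.Base using (Fin; toℕ)
import Data.Fin.Properties as Fin
open import Data.Nat.Base as ℕ using (ℕ; zero; suc; _∸_; _⊔_; _<ᵇ_)
import Data.Nat.Properties as ℕ
open import Data.Product.Base using (Σ-syntax; ∃-syntax; _×_; _,_; proj₁; proj₂)
open import Data.Rational.Base as ℚ using (ℚ; 0ℚ; 1ℚ; ½; ∣_∣; 1/_)
import Data.Rational.Properties as ℚ
open import Data.Rational.Solver using (module +-*-Solver)
open import Data.Vec.Functional using (Vector)
import Level
open import Level using (Level; 0ℓ)
open import Relation.Binary.PropositionalEquality.Core
  using (_≡_; refl; sym; trans; cong; cong₂; subst)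
open import Relation.Binary.Structures using (IsEquivalence)
open import Relation.Nullary.Decidable.Core using (does)

module _ where
  open import Data.Rational.Base using (_<_; _≤_; _+_; _*_; _-_; -_)
  open +-*-Solver

  half-pos : ∀ {ε} → 0ℚ < ε → 0ℚ < ½ * ε
  half-pos {ε} ε>0 = subst (_< ½ * ε) (ℚ.*-zeroʳ ½) (ℚ.*-monoʳ-<-pos ½ ε>0)

  half+half : ∀ ε → ½ * ε + ½ * ε ≡ ε
  half+half ε = trans (sym (ℚ.*-distribʳ-+ ε ½ ½)) (ℚ.*-identityˡ ε)

  ∣x-y∣-comm : ∀ p q → ∣ p - q ∣ ≡ ∣ q - p ∣
  ∣x-y∣-comm p q = trans (sym (ℚ.∣-p∣≡∣p∣ (p - q)))
    (cong ∣_∣ (solve 2 (λ p q → :- (p :- q) := q :- p) refl p q))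

  ∣x+y∣< : ∀ {p q ε} → ∣ p ∣ < ½ * ε → ∣ q ∣ < ½ * ε → ∣ p + q ∣ < ε
  ∣x+y∣< {p} {q} {ε} p< q< = ℚ.≤-<-trans (ℚ.∣p+q∣≤∣p∣+∣q∣ p q)
    (subst (∣ p ∣ + ∣ q ∣ <_) (half+half ε) (ℚ.+-mono-< p< q<))

  ∣x-z∣< : ∀ {p q r ε} → ∣ p - q ∣ < ½ * ε → ∣ q - r ∣ < ½ * ε → ∣ p - r ∣ < ε
  ∣x-z∣< {p} {q} {r} {ε} pq qr = subst (λ t → ∣ t ∣ < ε)
    (solve 3 (λ p q r → (p :- q) :+ (q :- r) := p :- r) refl p q r) (∣x+y∣< pq qr)

  ∣x*y∣< : ∀ {p q B δ} → 0ℚ < B → ∣ p ∣ < B → ∣ q ∣ < δ → ∣ p * q ∣ < B * δ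
  ∣x*y∣< {p} {q} {B} {δ} B>0 p< q< = subst (_< B * δ) (sym (ℚ.∣p*q∣≡∣p∣*∣q∣ p q))
    (ℚ.≤-<-trans (ℚ.*-monoʳ-≤-nonNeg ∣ q ∣ {{ℚ.∣-∣-nonNeg q}} (ℚ.<⇒≤ p<))
                 (ℚ.*-monoʳ-<-pos B {{ℚ.positive B>0}} q<))

  ∣sum-diff∣< : ∀ {a b c d ε} → ∣ a - c ∣ < ½ * ε → ∣ b - d ∣ < ½ * ε →
                ∣ (a + b) - (c + d) ∣ < ε
  ∣sum-diff∣< {a} {b} {c} {d} {ε} ac bd = subst (λ t → ∣ t ∣ < ε)
    (solve 4 (λ a b c d → (a :- c) :+ (b :- d) := (a :+ b) :- (c :+ d)) refl a b c d)
    (∣x+y∣< ac bd)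

  ∣neg-diff∣< : ∀ {a b ε} → ∣ a - b ∣ < ε → ∣ (- a) - (- b) ∣ < ε
  ∣neg-diff∣< {a} {b} {ε} ab = subst (_< ε)
    (trans (∣x-y∣-comm a b)
           (cong ∣_∣ (solve 2 (λ a b → b :- a := (:- a) :- (:- b)) refl a b))) ab

  ∣prod-diff∣< : ∀ {a b c d A B δ η ε} → 0ℚ < A → 0ℚ < B →
                 A * δ ≡ ½ * ε → B * η ≡ ½ * ε →
                 ∣ a ∣ < A → ∣ d ∣ < B → ∣ b - d ∣ < δ → ∣ a - c ∣ < η →
                 ∣ (a * b) - (c * d) ∣ < ε
  ∣prod-diff∣< {a} {b} {c} {d} {A} {B} {δ} {η} {ε} A>0 B>0 Aδ Bη a< d< bd ac =
    subst (λ t → ∣ t ∣ < ε)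
      (solve 4 (λ a b c d → a :* (b :- d) :+ d :* (a :- c) := (a :* b) :- (c :* d))
        refl a b c d)
      (∣x+y∣< (subst (∣ a * (b - d) ∣ <_) Aδ (∣x*y∣< A>0 a< bd))
              (subst (∣ d * (a - c) ∣ <_) Bη (∣x*y∣< B>0 d< ac)))

  divide : ∀ {B ε} → 0ℚ < B → 0ℚ < ε → Σ[ δ ∈ ℚ ] (0ℚ < δ) × (B * δ ≡ ε)
  divide {B} {ε} B>0 ε>0 = 1/B * ε , δ>0 ,
    trans (sym (ℚ.*-assoc B 1/B ε)) (trans (cong (_* ε) (ℚ.*-inverseʳ B)) (ℚ.*-identityˡ ε))
    where
    instance
      B-pos : ℚ.Positive B
      B-pos = ℚ.positive B>0
      B≢0 : ℚ.NonZero B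
      B≢0 = ℚ.pos⇒nonZero B
    1/B = 1/ B
    δ>0 : 0ℚ < 1/B * ε
    δ>0 = subst (_< 1/B * ε) (ℚ.*-zeroʳ 1/B)
      (ℚ.*-monoʳ-<-pos 1/B {{ℚ.1/pos⇒pos B}} ε>0)

IsCauchy : (ℕ → ℚ) → Set
IsCauchy x = ∀ ε → 0ℚ ℚ.< ε →
  ∃[ N ] (∀ m n → N ℕ.≤ m → N ℕ.≤ n → ∣ x m ℚ.- x n ∣ ℚ.< ε)

-- Real numbers are Cauchy sequences of rationals, identified by _≃_ when their
-- difference is a null sequence. Eta is switched off so that conversion checking
-- does not compare the (proof-relevant but inessential) Cauchy moduli.
record ℝ : Set where
  no-eta-equality
  field
    approx : ℕ → ℚ
    cauchy : IsCauchy approx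

open ℝ public

infix 4 _≃_

record _≃_ (x y : ℝ) : Set where
  no-eta-equality
  field
    close : ∀ ε → 0ℚ ℚ.< ε →
      ∃[ N ] (∀ n → N ℕ.≤ n → ∣ approx x n ℚ.- approx y n ∣ ℚ.< ε)

open _≃_ public

fromℚ : ℚ → ℝ
fromℚ q .approx _ = q
fromℚ q .cauchy ε ε>0 = 0 , λ _ _ _ _ →
  subst (λ t → ∣ t ∣ ℚ.< ε) (sym (ℚ.+-inverseʳ q)) ε>0

0ℝ 1ℝ : ℝ
0ℝ = fromℚ 0ℚ
1ℝ = fromℚ 1ℚ

private
  ⊔ˡ : ∀ {M N n} → M ⊔ N ℕ.≤ n → M ℕ.≤ n
  ⊔ˡ {M} {N} = ℕ.≤-trans (ℕ.m≤m⊔n M N)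

  ⊔ʳ : ∀ {M N n} → M ⊔ N ℕ.≤ n → N ℕ.≤ n
  ⊔ʳ {M} {N} = ℕ.≤-trans (ℕ.m≤n⊔m M N)

bounded : ∀ x → Σ[ B ∈ ℚ ] (0ℚ ℚ.< B) × ∃[ N ] (∀ n → N ℕ.≤ n → ∣ approx x n ∣ ℚ.< B)
bounded x = B , B>0 , N , bound
  where
  open import Data.Rational.Base using (_<_; _+_; _-_)
  open +-*-Solver
  modulus = cauchy x 1ℚ (ℚ.positive⁻¹ 1ℚ)
  N = proj₁ modulus
  c = approx x N
  B = 1ℚ + ∣ c ∣
  B>0 : 0ℚ < B
  B>0 = ℚ.+-mono-<-≤ (ℚ.positive⁻¹ 1ℚ) (ℚ.0≤∣p∣ c)
  bound : ∀ n → N ℕ.≤ n → ∣ approx x n ∣ < B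
  bound n N≤n = subst (λ t → ∣ t ∣ < B)
    (solve 2 (λ a c → (a :- c) :+ c := a) refl (approx x n) c)
    (ℚ.≤-<-trans (ℚ.∣p+q∣≤∣p∣+∣q∣ (approx x n - c) c)
      (ℚ.+-monoˡ-< ∣ c ∣ (proj₂ modulus n N N≤n ℕ.≤-refl)))

infixl 6 _+ℝ_
infixl 7 _*ℝ_
infix  8 -ℝ_

_+ℝ_ : ℝ → ℝ → ℝ
(x +ℝ y) .approx n = approx x n ℚ.+ approx y n
(x +ℝ y) .cauchy ε ε>0 =
  let M , xM = cauchy x (½ ℚ.* ε) (half-pos ε>0)
      N , yN = cauchy y (½ ℚ.* ε) (half-pos ε>0)
  in M ⊔ N , λ m n ≤m ≤n →
       ∣sum-diff∣< {approx x m} {approx y m}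
         (xM m n (⊔ˡ ≤m) (⊔ˡ ≤n)) (yN m n (⊔ʳ {M} ≤m) (⊔ʳ {M} ≤n))

-ℝ_ : ℝ → ℝ
(-ℝ x) .approx n = ℚ.- approx x n
(-ℝ x) .cauchy ε ε>0 =
  let M , xM = cauchy x ε ε>0
  in M , λ m n ≤m ≤n → ∣neg-diff∣< {approx x m} (xM m n ≤m ≤n)

_*ℝ_ : ℝ → ℝ → ℝ
(x *ℝ y) .approx n = approx x n ℚ.* approx y n
(x *ℝ y) .cauchy ε ε>0 =
  let A , A>0 , K , xK = bounded x
      B , B>0 , L , yL = bounded y
      δ , δ>0 , Aδ = divide A>0 (half-pos ε>0)
      η , η>0 , Bη = divide B>0 (half-pos ε>0)
      M , xM = cauchy x η η>0
      N , yN = cauchy y δ δ>0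
  in (K ⊔ L) ⊔ (M ⊔ N) , λ m n ≤m ≤n →
       ∣prod-diff∣< {approx x m} {approx y m} {approx x n} {approx y n}
         A>0 B>0 Aδ Bη
         (xK m (⊔ˡ {K} (⊔ˡ ≤m))) (yL n (⊔ʳ {K} (⊔ˡ ≤n)))
         (yN m n (⊔ʳ {M} (⊔ʳ {K ⊔ L} ≤m)) (⊔ʳ {M} (⊔ʳ {K ⊔ L} ≤n)))
         (xM m n (⊔ˡ {M} (⊔ʳ {K ⊔ L} ≤m)) (⊔ˡ {M} (⊔ʳ {K ⊔ L} ≤n)))

pointwise⇒≃ : ∀ {x y} → (∀ n → approx x n ≡ approx y n) → x ≃ y
pointwise⇒≃ {x} {y} x≗y .close ε ε>0 = 0 , λ n _ →
  subst (λ t → ∣ t ∣ ℚ.< ε)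
    (sym (trans (cong (ℚ._- approx y n) (x≗y n)) (ℚ.+-inverseʳ (approx y n)))) ε>0

≃-isEquivalence : IsEquivalence _≃_
≃-isEquivalence .IsEquivalence.refl = pointwise⇒≃ λ _ → refl
≃-isEquivalence .IsEquivalence.sym {x} {y} x≃y .close ε ε>0 =
  let N , xy = close x≃y ε ε>0
  in N , λ n N≤n → subst (ℚ._< ε) (∣x-y∣-comm (approx x n) (approx y n)) (xy n N≤n)
≃-isEquivalence .IsEquivalence.trans {x} {y} {z} x≃y y≃z .close ε ε>0 =
  let M , xy = close x≃y (½ ℚ.* ε) (half-pos ε>0)
      N , yz = close y≃z (½ ℚ.* ε) (half-pos ε>0)
  in M ⊔ N , λ n ≤n →
       ∣x-z∣< {approx x n} {approx y n} (xy n (⊔ˡ ≤n)) (yz n (⊔ʳ {M} ≤n))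

+ℝ-cong : ∀ {x y u v} → x ≃ y → u ≃ v → x +ℝ u ≃ y +ℝ v
+ℝ-cong {x} {y} {u} {v} x≃y u≃v .close ε ε>0 =
  let M , xy = close x≃y (½ ℚ.* ε) (half-pos ε>0)
      N , uv = close u≃v (½ ℚ.* ε) (half-pos ε>0)
  in M ⊔ N , λ n ≤n →
       ∣sum-diff∣< {approx x n} {approx u n} (xy n (⊔ˡ ≤n)) (uv n (⊔ʳ {M} ≤n))

-ℝ-cong : ∀ {x y} → x ≃ y → -ℝ x ≃ -ℝ y
-ℝ-cong {x} x≃y .close ε ε>0 =
  let N , xy = close x≃y ε ε>0
  in N , λ n N≤n → ∣neg-diff∣< {approx x n} (xy n N≤n)

*ℝ-cong : ∀ {x y u v} → x ≃ y → u ≃ v → x *ℝ u ≃ y *ℝ v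
*ℝ-cong {x} {y} {u} {v} x≃y u≃v .close ε ε>0 =
  let A , A>0 , K , xK = bounded x
      B , B>0 , L , vL = bounded v
      δ , δ>0 , Aδ = divide A>0 (half-pos ε>0)
      η , η>0 , Bη = divide B>0 (half-pos ε>0)
      M , xy = close x≃y η η>0
      N , uv = close u≃v δ δ>0
  in (K ⊔ L) ⊔ (M ⊔ N) , λ n ≤n →
       ∣prod-diff∣< {approx x n} {approx u n} {approx y n} {approx v n}
         A>0 B>0 Aδ Bη
         (xK n (⊔ˡ {K} (⊔ˡ ≤n))) (vL n (⊔ʳ {K} (⊔ˡ ≤n)))
         (uv n (⊔ʳ {M} (⊔ʳ {K ⊔ L} ≤n))) (xy n (⊔ˡ {M} (⊔ʳ {K ⊔ L} ≤n)))

ℝ-isCommutativeRing : IsCommutativeRing _≃_ _+ℝ_ _*ℝ_ -ℝ_ 0ℝ 1ℝ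
ℝ-isCommutativeRing = record
  { isRing = record
    { +-isAbelianGroup = record
      { isGroup = record
        { isMonoid = record
          { isSemigroup = record
            { isMagma = record
              { isEquivalence = ≃-isEquivalence
              ; ∙-cong        = +ℝ-cong
              }
            ; assoc = λ x y z → pointwise⇒≃ λ n →
                ℚ.+-assoc (approx x n) (approx y n) (approx z n)
            }
          ; identity = (λ x → pointwise⇒≃ λ n → ℚ.+-identityˡ (approx x n))
                     , (λ x → pointwise⇒≃ λ n → ℚ.+-identityʳ (approx x n))
          }
        ; inverse = (λ x → pointwise⇒≃ λ n → ℚ.+-inverseˡ (approx x n))
                  , (λ x → pointwise⇒≃ λ n → ℚ.+-inverseʳ (approx x n))
        ; ⁻¹-cong = -ℝ-cong
        }
      ; comm = λ x y → pointwise⇒≃ λ n → ℚ.+-comm (approx x n) (approx y n)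
      }
    ; *-cong = *ℝ-cong
    ; *-assoc = λ x y z → pointwise⇒≃ λ n →
        ℚ.*-assoc (approx x n) (approx y n) (approx z n)
    ; *-identity = (λ x → pointwise⇒≃ λ n → ℚ.*-identityˡ (approx x n))
                 , (λ x → pointwise⇒≃ λ n → ℚ.*-identityʳ (approx x n))
    ; distrib = (λ x y z → pointwise⇒≃ λ n →
                  ℚ.*-distribˡ-+ (approx x n) (approx y n) (approx z n))
              , (λ x y z → pointwise⇒≃ λ n →
                  ℚ.*-distribʳ-+ (approx x n) (approx y n) (approx z n))
    }
  ; *-comm = λ x y → pointwise⇒≃ λ n → ℚ.*-comm (approx x n) (approx y n)
  }

ℝ-commutativeRing : CommutativeRing 0ℓ 0ℓ
ℝ-commutativeRing = record { isCommutativeRing = ℝ-isCommutativeRing }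

module VerticallyRecurrent {c ℓ : Level} (R : CommutativeRing c ℓ) where
  open CommutativeRing R
    renaming (Carrier to A; refl to ≈-refl; _+_ to _⊞_; _*_ to _⊡_)
  open import Algebra.Definitions.RawSemiring (Semiring.rawSemiring semiring)
    using (_^_; sum) renaming (_×_ to _·_)

  Matrix : ℕ → Set c
  Matrix n = Vector (Vector A n) n

  infix 4 _≈ᴹ_
  _≈ᴹ_ : ∀ {n} → Matrix n → Matrix n → Set ℓ
  M ≈ᴹ N = ∀ i j → M i j ≈ N i j

  identityᴹ : ∀ {n} → Matrix n
  identityᴹ i j = if does (i Fin.≟ j) then 1# else 0#

  infixl 7 _*ᴹ_
  _*ᴹ_ : ∀ {n} → Matrix n → Matrix n → Matrix n
  (M *ᴹ N) i j = sum λ k → M i k ⊡ N k j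

  infixr 8 _^ᴹ_
  _^ᴹ_ : ∀ {n} → Matrix n → ℕ → Matrix n
  M ^ᴹ zero  = identityᴹ
  M ^ᴹ suc m = M *ᴹ (M ^ᴹ m)

  record AssociatedSequence : Set (c Level.⊔ ℓ) where
    field
      term   : ℕ → A
      term-0 : term 0 ≈ 1#

  open AssociatedSequence public

  -- In the recursive clause l = j + t runs over j ≤ l ≤ i - 1, so that all the
  -- truncated subtractions are exact; here the column index is j + 1.
  entry : (ℕ → A) → ℕ → ℕ → A
  entry Λ i zero    = Λ i
  entry Λ i (suc j) =
    if i <ᵇ suc j then 0# else
    sum {i ∸ j} (λ t → Λ (i ∸ 1 ∸ (j ℕ.+ toℕ t)) ⊡ entry Λ (j ℕ.+ toℕ t) j)

  -- V n Λ has order n + 1.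
  V : (n : ℕ) → AssociatedSequence → Matrix (suc n)
  V n Λ i j = entry (term Λ) (toℕ i) (toℕ j)

  powers : A → AssociatedSequence
  powers x .term i = x ^ i
  powers x .term-0 = ≈-refl

  fromℕ : ℕ → A
  fromℕ m = m · 1#

open VerticallyRecurrent ℝ-commutativeRing public

-- Over any commutative ring, the entries a_{i,j} of the matrix with associated
-- sequence λⁿ satisfy a_{i+1,j+1} = a_{i,j} + λ a_{i,j+1}, obtained by splitting
-- off the last summand of the recursive definition. Hence they form the
-- generalized Pascal triangle P(λ)_{i,j} = C(i,j) λ^{i-j}, and it remains to see
-- that λ ↦ P(λ) is a homomorphism: P(λ) P(μ) = P(λ + μ), P(0) = I.
module Submission where

open import Algebra.Bundles using (CommutativeRing)
import Algebra.Properties.CommutativeSemigroup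
import Algebra.Properties.Semiring.Exp
import Algebra.Properties.Semiring.Sum
open import Data.Fin.Base as Fin using (Fin; zero; suc; toℕ; inject₁)
import Data.Fin.Properties as Fin
open import Data.Nat.Base as ℕ using (ℕ; zero; suc; _≤_; _<_; _∸_; z≤n; s≤s; s≤s⁻¹)
import Data.Nat.Properties as ℕ
open import Data.Product.Base using (_,_)
open import Relation.Binary.PropositionalEquality.Core as ≡ using (_≡_)
open import Relation.Nullary.Decidable using (dec-true; dec-false; yes; no)
import Relation.Binary.Reasoning.Setoid
open import Defs using (module VerticallyRecurrent)

module PascalMatrices {c ℓ} (R : CommutativeRing c ℓ) where
  open CommutativeRing R hiding (zero) renaming (Carrier to A)
  open VerticallyRecurrent R
  open Algebra.Properties.Semiring.Exp semiring using (_^_; ^-congʳ)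
  open Algebra.Properties.Semiring.Sum semiring
  open Algebra.Properties.CommutativeSemigroup +-commutativeSemigroup
    using (x∙yz≈y∙xz)
  open Algebra.Properties.CommutativeSemigroup *-commutativeSemigroup
    using () renaming (x∙yz≈y∙xz to x*yz≈y*xz)
  open Relation.Binary.Reasoning.Setoid setoid

  -- Recursion on rows avoids binomial coefficients and truncated exponents, and column 0 unfolds
  -- exactly as `_^_` does.
  pascal : A → ℕ → ℕ → A
  pascal x zero    zero    = 1#
  pascal x zero    (suc j) = 0#
  pascal x (suc i) zero    = x * pascal x i zero
  pascal x (suc i) (suc j) = pascal x i j + x * pascal x i (suc j)

  pascal-cong : ∀ {x y} → x ≈ y → ∀ i j → pascal x i j ≈ pascal y i j
  pascal-cong x≈y zero    zero    = refl
  pascal-cong x≈y zero    (suc j) = refl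
  pascal-cong x≈y (suc i) zero    = *-cong x≈y (pascal-cong x≈y i zero)
  pascal-cong x≈y (suc i) (suc j) =
    +-cong (pascal-cong x≈y i j) (*-cong x≈y (pascal-cong x≈y i (suc j)))

  identityᴹ≈pascal-0 : ∀ {n} (i j : Fin n) → identityᴹ i j ≈ pascal 0# (toℕ i) (toℕ j)
  identityᴹ≈pascal-0 zero    zero    = refl
  identityᴹ≈pascal-0 zero    (suc j) = refl
  identityᴹ≈pascal-0 (suc i) zero    = sym (zeroˡ _)
  identityᴹ≈pascal-0 (suc i) (suc j) = begin
    -- `does (suc i Fin.≟ suc j)` reduces to `does (i Fin.≟ j)`, so moving down the diagonal is
    -- definitional.
    identityᴹ i j
      ≈⟨ identityᴹ≈pascal-0 i j ⟩
    pascal 0# (toℕ i) (toℕ j)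
      ≈⟨ +-identityʳ _ ⟨
    pascal 0# (toℕ i) (toℕ j) + 0#
      ≈⟨ +-congˡ (zeroˡ _) ⟨
    pascal 0# (toℕ i) (toℕ j) + 0# * pascal 0# (toℕ i) (toℕ (suc j)) ∎

  sum-zeroˡ : ∀ n (f : Fin n → A) → sum (λ k → 0# * f k) ≈ 0#
  sum-zeroˡ n f = trans (sym (*-distribˡ-sum 0# f)) (zeroˡ _)

  -- Row `suc i` is row `i` shifted by one column plus `x` times row `i`; in the sum, the shift
  -- passes to `q` and costs one term.
  sum-pascal-suc : ∀ x n i (q : ℕ → A) →
    sum {suc n} (λ k → pascal x (suc i) (toℕ k) * q (toℕ k)) ≈
    sum {n} (λ k → pascal x i (toℕ k) * q (suc (toℕ k))) +
    x * sum {suc n} (λ k → pascal x i (toℕ k) * q (toℕ k))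
  sum-pascal-suc x n i q = begin
    x * p 0 * q 0 + sum {n} (λ k → (p (toℕ k) + x * p (suc (toℕ k))) * q (suc (toℕ k)))
      ≈⟨ +-cong (*-assoc _ _ _) (sum-cong-≋ {n} λ k →
           trans (distribʳ _ _ _) (+-congˡ (*-assoc _ _ _))) ⟩
    x * (p 0 * q 0) +
    sum {n} (λ k → p (toℕ k) * q (suc (toℕ k)) + x * (p (suc (toℕ k)) * q (suc (toℕ k))))
      ≈⟨ +-congˡ (∑-distrib-+ {n} _ _) ⟩
    x * (p 0 * q 0) +
    (sum {n} (λ k → p (toℕ k) * q (suc (toℕ k))) +
     sum {n} (λ k → x * (p (suc (toℕ k)) * q (suc (toℕ k)))))
      -- The term at column 0 rejoins the second sum as its head, restoring length `suc n`.
      ≈⟨ x∙yz≈y∙xz _ _ _ ⟩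
    sum {n} (λ k → p (toℕ k) * q (suc (toℕ k))) +
    sum {suc n} (λ k → x * (p (toℕ k) * q (toℕ k)))
      ≈⟨ +-congˡ (*-distribˡ-sum {suc n} x (λ k → p (toℕ k) * q (toℕ k))) ⟨
    sum {n} (λ k → p (toℕ k) * q (suc (toℕ k))) +
    x * sum {suc n} (λ k → p (toℕ k) * q (toℕ k)) ∎
    where
    p = pascal x i

  -- The truncation to k < n is harmless for i < n, as row i vanishes beyond column i.
  pascal-+ : ∀ x y {n i} → i < n → ∀ j →
    sum {n} (λ k → pascal x i (toℕ k) * pascal y (toℕ k) j) ≈ pascal (x + y) i j
  pascal-+ x y {suc n} {zero} i<n j = begin
    1# * pascal y 0 j + sum {n} (λ k → 0# * pascal y (suc (toℕ k)) j)
      ≈⟨ +-cong (*-identityˡ _) (sum-zeroˡ n _) ⟩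
    pascal y 0 j + 0#
      ≈⟨ +-identityʳ _ ⟩
    pascal y 0 j
      ≡⟨ row-0 j ⟩
    pascal (x + y) 0 j ∎
    where
    -- Row 0 is independent of the parameter, but `pascal` reduces only once `j` is split.
    row-0 : ∀ j → pascal y 0 j ≡ pascal (x + y) 0 j
    row-0 zero    = ≡.refl
    row-0 (suc j) = ≡.refl
  -- The sums from `sum-pascal-suc` have lengths `n` and `suc n`, so the induction on `i` uses its
  -- hypothesis at both bounds.
  pascal-+ x y {suc n} {suc i} i<n zero = begin
    sum {suc n} (λ k → pascal x (suc i) (toℕ k) * pascal y (toℕ k) 0)
      ≈⟨ sum-pascal-suc x n i (λ k → pascal y k 0) ⟩
    sum {n} (λ k → pascal x i (toℕ k) * (y * pascal y (toℕ k) 0)) +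
    x * sum {suc n} (λ k → pascal x i (toℕ k) * pascal y (toℕ k) 0)
      ≈⟨ +-cong (sum-cong-≋ {n} λ k → x*yz≈y*xz _ _ _)
                (*-congˡ (pascal-+ x y (ℕ.m<n⇒m<1+n (s≤s⁻¹ i<n)) 0)) ⟩
    sum {n} (λ k → y * (pascal x i (toℕ k) * pascal y (toℕ k) 0)) + x * pascal (x + y) i 0
      ≈⟨ +-congʳ (*-distribˡ-sum {n} y _) ⟨
    y * sum {n} (λ k → pascal x i (toℕ k) * pascal y (toℕ k) 0) + x * pascal (x + y) i 0
      ≈⟨ +-congʳ (*-congˡ (pascal-+ x y (s≤s⁻¹ i<n) 0)) ⟩
    y * pascal (x + y) i 0 + x * pascal (x + y) i 0
      ≈⟨ +-comm _ _ ⟩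
    x * pascal (x + y) i 0 + y * pascal (x + y) i 0
      ≈⟨ distribʳ _ _ _ ⟨
    (x + y) * pascal (x + y) i 0 ∎
  pascal-+ x y {suc n} {suc i} i<n (suc j) = begin
    sum {suc n} (λ k → pascal x (suc i) (toℕ k) * pascal y (toℕ k) (suc j))
      ≈⟨ sum-pascal-suc x n i (λ k → pascal y k (suc j)) ⟩
    -- The shift of `q` exposes row `suc k` of `pascal y`, whose own recurrence leads to the
    -- hypothesis in columns `j` and `suc j`.
    sum {n} (λ k → p (toℕ k) * (pascal y (toℕ k) j + y * pascal y (toℕ k) (suc j))) +
    x * sum {suc n} (λ k → p (toℕ k) * pascal y (toℕ k) (suc j))
      ≈⟨ +-cong (sum-cong-≋ {n} λ k → trans (distribˡ _ _ _) (+-congˡ (x*yz≈y*xz _ _ _)))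
                (*-congˡ (pascal-+ x y (ℕ.m<n⇒m<1+n (s≤s⁻¹ i<n)) (suc j))) ⟩
    sum {n} (λ k → p (toℕ k) * pascal y (toℕ k) j + y * (p (toℕ k) * pascal y (toℕ k) (suc j))) +
    x * r (suc j)
      ≈⟨ +-congʳ (∑-distrib-+ {n} _ _) ⟩
    sum {n} (λ k → p (toℕ k) * pascal y (toℕ k) j) +
    sum {n} (λ k → y * (p (toℕ k) * pascal y (toℕ k) (suc j))) +
    x * r (suc j)
      ≈⟨ +-congʳ (+-congˡ (*-distribˡ-sum {n} y _)) ⟨
    sum {n} (λ k → p (toℕ k) * pascal y (toℕ k) j) +
    y * sum {n} (λ k → p (toℕ k) * pascal y (toℕ k) (suc j)) +
    x * r (suc j)
      ≈⟨ +-congʳ (+-cong (pascal-+ x y (s≤s⁻¹ i<n) j)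
                         (*-congˡ (pascal-+ x y (s≤s⁻¹ i<n) (suc j)))) ⟩
    r j + y * r (suc j) + x * r (suc j)
      ≈⟨ +-assoc _ _ _ ⟩
    r j + (y * r (suc j) + x * r (suc j))
      ≈⟨ +-congˡ (+-comm _ _) ⟩
    r j + (x * r (suc j) + y * r (suc j))
      ≈⟨ +-congˡ (distribʳ _ _ _) ⟨
    r j + (x + y) * r (suc j) ∎
    where
    p = pascal x i
    r = pascal (x + y) i

  entry-upper : ∀ Λ {i j} → i < suc j → entry Λ i (suc j) ≡ 0#
  -- `does (i ℕ.<? suc j)` is definitionally the test `i <ᵇ suc j` inside `entry`.
  entry-upper Λ {i} {j} i<1+j rewrite dec-true (i ℕ.<? suc j) i<1+j = ≡.refl

  -- Writing the row as `j + d` makes the subtractions disappear. The case `d = 0` lies just above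
  -- the diagonal, where the empty sum agrees with the default `0#`.
  entry-lower : ∀ Λ j d → entry Λ (j ℕ.+ d) (suc j) ≡
    sum {d} (λ t → Λ (d ∸ suc (toℕ t)) * entry Λ (j ℕ.+ toℕ t) j)
  entry-lower Λ j zero    = entry-upper Λ (ℕ.≤-reflexive (≡.cong suc (ℕ.+-identityʳ j)))
  entry-lower Λ j (suc d)
    rewrite dec-false (j ℕ.+ suc d ℕ.<? suc j) (ℕ.≤⇒≯ (ℕ.m<m+n j ℕ.z<s)) =
    -- The length of the sum also fixes the type of its index; a summand defined on all of `ℕ` lets
    -- the length be rewritten alone.
    ≡.trans (≡.cong (λ n → sum {n} (summand ∘toℕ)) (ℕ.m+n∸m≡n j (suc d)))
            (sum-cong-≗ {suc d} λ t →
               ≡.cong (λ s → Λ s * entry Λ (j ℕ.+ toℕ t) j) (exponent (toℕ t)))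
    where
    summand : ℕ → A
    summand t = Λ (j ℕ.+ suc d ∸ 1 ∸ (j ℕ.+ t)) * entry Λ (j ℕ.+ t) j
    _∘toℕ : (ℕ → A) → ∀ {n} → Fin n → A
    (f ∘toℕ) t = f (toℕ t)
    exponent : ∀ t → j ℕ.+ suc d ∸ 1 ∸ (j ℕ.+ t) ≡ d ∸ t
    exponent t = ≡.trans (≡.cong (λ s → s ∸ 1 ∸ (j ℕ.+ t)) (ℕ.+-suc j d))
                         (ℕ.[m+n]∸[m+o]≡n∸o j d t)

  -- A Horner step: the last term has exponent 0, and every earlier one has a factor `x` to spare.
  sum-powers-suc : ∀ x d (f : ℕ → A) →
    sum {suc d} (λ t → x ^ (d ∸ toℕ t) * f (toℕ t)) ≈
    f d + x * sum {d} (λ t → x ^ (d ∸ suc (toℕ t)) * f (toℕ t))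
  sum-powers-suc x d f = begin
    sum {suc d} summand
      ≈⟨ sum-init-last {d} summand ⟩
    sum {d} (λ t → summand (inject₁ t)) + summand (Fin.fromℕ d)
      ≈⟨ +-cong (sum-cong-≋ {d} init-step) last-step ⟩
    sum {d} (λ t → x * (x ^ (d ∸ suc (toℕ t)) * f (toℕ t))) + f d
      ≈⟨ +-comm _ _ ⟩
    f d + sum {d} (λ t → x * (x ^ (d ∸ suc (toℕ t)) * f (toℕ t)))
      ≈⟨ +-congˡ (*-distribˡ-sum {d} x _) ⟨
    f d + x * sum {d} (λ t → x ^ (d ∸ suc (toℕ t)) * f (toℕ t)) ∎
    where
    summand : Fin (suc d) → A
    summand t = x ^ (d ∸ toℕ t) * f (toℕ t)
    init-step : ∀ t → summand (inject₁ t) ≈ x * (x ^ (d ∸ suc (toℕ t)) * f (toℕ t))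
    -- Since `toℕ t < d`, the exponent `d ∸ toℕ t` is a genuine successor.
    init-step t rewrite Fin.toℕ-inject₁ t =
      trans (*-congʳ (^-congʳ x (ℕ.+-∸-assoc 1 (Fin.toℕ<n t)))) (*-assoc _ _ _)
    last-step : summand (Fin.fromℕ d) ≈ f d
    last-step rewrite Fin.toℕ-fromℕ d | ℕ.n∸n≡0 d = *-identityˡ _

  -- On or below the diagonal, with `i = j + d`, both entries of column `suc j` are sums over column
  -- `j`, of lengths `suc d` and `d`, which the Horner step relates.
  entry-powers-suc : ∀ x i j → entry (x ^_) (suc i) (suc j) ≈
    entry (x ^_) i j + x * entry (x ^_) i (suc j)
  entry-powers-suc x i j with j ℕ.≤? i
  ... | yes j≤i with ℕ.m≤n⇒∃[o]m+o≡n j≤i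
  ...   | d , ≡.refl = begin
    entry Λ (suc (j ℕ.+ d)) (suc j)
      ≡⟨ ≡.cong (λ i → entry Λ i (suc j)) (ℕ.+-suc j d) ⟨
    entry Λ (j ℕ.+ suc d) (suc j)
      ≡⟨ entry-lower Λ j (suc d) ⟩
    sum {suc d} (λ t → x ^ (d ∸ toℕ t) * entry Λ (j ℕ.+ toℕ t) j)
      ≈⟨ sum-powers-suc x d (λ t → entry Λ (j ℕ.+ t) j) ⟩
    entry Λ (j ℕ.+ d) j + x * sum {d} (λ t → x ^ (d ∸ suc (toℕ t)) * entry Λ (j ℕ.+ toℕ t) j)
      ≡⟨ ≡.cong (λ s → entry Λ (j ℕ.+ d) j + x * s) (entry-lower Λ j d) ⟨
    entry Λ (j ℕ.+ d) j + x * entry Λ (j ℕ.+ d) (suc j) ∎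
    where
    Λ = x ^_
  -- All three entries lie above the diagonal. The column is split because `entry-upper` covers
  -- successor columns; column 0 contradicts `j≰i`.
  entry-powers-suc x i (suc j) | no j≰i = begin
    entry Λ (suc i) (suc (suc j))
      ≡⟨ entry-upper Λ (s≤s i<j) ⟩
    0#
      ≈⟨ zeroʳ x ⟨
    x * 0#
      ≈⟨ +-identityˡ _ ⟨
    0# + x * 0#
      ≡⟨ ≡.cong₂ (λ a b → a + x * b) (entry-upper Λ i<j) (entry-upper Λ (ℕ.m<n⇒m<1+n i<j)) ⟨
    entry Λ i (suc j) + x * entry Λ i (suc (suc j)) ∎
    where
    Λ = x ^_
    i<j = ℕ.≰⇒> j≰i
  entry-powers-suc x i zero | no j≰i with () ← j≰i z≤n

  entry-powers≈pascal : ∀ x i j → entry (x ^_) i j ≈ pascal x i j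
  entry-powers≈pascal x zero    zero    = refl
  entry-powers≈pascal x zero    (suc j) = refl
  entry-powers≈pascal x (suc i) zero    = *-congˡ (entry-powers≈pascal x i zero)
  entry-powers≈pascal x (suc i) (suc j) = trans (entry-powers-suc x i j)
    (+-cong (entry-powers≈pascal x i j) (*-congˡ (entry-powers≈pascal x i (suc j))))

  -- Induction from exponent 0, where the parameter `x * 0#` gives the identity; each further factor
  -- adds `x` to the parameter by `pascal-+`.
  V-powers-^ᴹ-pascal : ∀ x n m (i j : Fin (suc n)) →
    ((V n (powers x)) ^ᴹ m) i j ≈ pascal (x * fromℕ m) (toℕ i) (toℕ j)
  V-powers-^ᴹ-pascal x n zero    i j =
    trans (identityᴹ≈pascal-0 i j) (pascal-cong (sym (zeroʳ x)) (toℕ i) (toℕ j))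
  V-powers-^ᴹ-pascal x n (suc m) i j = begin
    sum (λ k → V n (powers x) i k * ((V n (powers x)) ^ᴹ m) k j)
      ≈⟨ sum-cong-≋ (λ k → *-cong (entry-powers≈pascal x (toℕ i) (toℕ k))
                                  (V-powers-^ᴹ-pascal x n m k j)) ⟩
    sum {suc n} (λ k → pascal x (toℕ i) (toℕ k) * pascal (x * fromℕ m) (toℕ k) (toℕ j))
      ≈⟨ pascal-+ x (x * fromℕ m) (Fin.toℕ<n i) (toℕ j) ⟩
    pascal (x + x * fromℕ m) (toℕ i) (toℕ j)
      ≈⟨ pascal-cong x+xm≈x[1+m] (toℕ i) (toℕ j) ⟩
    pascal (x * fromℕ (suc m)) (toℕ i) (toℕ j) ∎
    where
    x+xm≈x[1+m] : x + x * fromℕ m ≈ x * (1# + fromℕ m)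
    x+xm≈x[1+m] = sym (trans (distribˡ x 1# _) (+-congʳ (*-identityʳ x)))

  V-powers-^ᴹ : ∀ x n m → (V n (powers x)) ^ᴹ m ≈ᴹ V n (powers (x * fromℕ m))
  V-powers-^ᴹ x n m i j =
    trans (V-powers-^ᴹ-pascal x n m i j) (sym (entry-powers≈pascal _ (toℕ i) (toℕ j)))

open import Defs

theorem3p3 : ∀ (x : ℝ) (n m : ℕ) → 1 ≤ m →
    (V n (powers x)) ^ᴹ m ≈ᴹ V n (powers (x *ℝ fromℕ m))
theorem3p3 x n m _ = PascalMatrices.V-powers-^ᴹ ℝ-commutativeRing x n m
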